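{- Let $m\ge 0$ be an odd integer such that $\frac{m-1}{2}\equiv -3 \pmod{z(13)}$. Then the bi-periodic Perrin quaternion $QR_m(11,13)$ is invertible in the quaternion algebra $Q_{\mathbb{Z}_{13}}$.
   Context: The bi-periodic Perrin sequence $\{R_n(a,b)\}_{n\ge 0}$ is defined by $R_0(a,b)=3$, $R_1(a,b)=0$, $R_2(a,b)=2$ and, for $n\ge 3$, $R_n(a,b)=aR_{n-2}(a,b)+R_{n-3}(a,b)$ if $n$ is even, $R_n(a,b)=bR_{n-2}(a,b)+R_{n-3}(a,b)$ if $n$ is odd. The sequence $R_n(b,a)$ is obtained by interchanging the roles of $a$ and $b$. The bi-periodic Perrin quaternion is $QR_n(a,b)=R_n(a,b)+R_{n+1}(b,a)i+R_{n+2}(a,b)j+R_{n+3}(b,a)k$ if $n$ is even, and $QR_n(a,b)=R_n(b,a)+R_{n+1}(a,b)i+R_{n+2}(b,a)j+R_{n+3}(a,b)k$ if $n$ is odd; here its integer coefficients are reduced modulo $p=13$. $Q_{\mathbb{Z}_p}$ is the quaternion algebra over the field $\mathbb{Z}_p=\mathbb{Z}/p\mathbb{Z}$ with basis $1,i,j,k$ and $i^2=j^2=-1$, $ij=-ji=k$. $\{F_n\}_{n\ge0}$ is the Fibonacci sequence ($F_0=0$, $F_1=1$, $F_n=F_{n-1}+F_{n-2}$), and the entry point $z(p)$ is the smallest positive integer $z$ with $p\mid F_z$. -}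

module Defs where

open import Level using (0ℓ)
open import Algebra.Bundles using (CommutativeRing)
import Algebra.Definitions as AlgebraDefinitions
open import Data.Integer.Base as ℤ using (ℤ; +_; 0ℤ; 1ℤ)
open import Data.Integer.Divisibility.Signed as ℤ∣ using ()
import Data.Integer.Properties as ℤ
open import Data.Integer.Tactic.RingSolver using (solve-∀)
open import Data.Nat.Base as ℕ using (ℕ; zero; suc; parity)
open import Data.Nat.Divisibility using (_∣_)
open import Data.Parity.Base using (Parity; 0ℙ; 1ℙ)
open import Data.Product.Base using (_,_)
open import Relation.Binary.PropositionalEquality
  using (_≡_; refl; subst)

F : ℕ → ℕ
F 0 = 0
F 1 = 1
F (suc (suc n)) = F (suc n) ℕ.+ F n

record IsEntryPoint (p z : ℕ) : Set where
  field
    positive : 0 ℕ.< z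
    divides  : p ∣ F z
    minimal  : ∀ {k} → 0 ℕ.< k → p ∣ F k → z ℕ.≤ k

infix 4 _≡_[mod_]

-- A record, rather than a synonym for the divisibility, so that x and y
-- can be inferred from the type.
record _≡_[mod_] (x y : ℤ) (n : ℕ) : Set where
  constructor congruent
  field
    n∣x-y : + n ℤ∣.∣ x ℤ.- y

module _ {n : ℕ} where

  private
    infix 4 _≈_
    _≈_ : ℤ → ℤ → Set
    x ≈ y = x ≡ y [mod n ]

  mod-reflexive : ∀ {x y} → x ≡ y → x ≈ y
  mod-reflexive {x} refl =
    congruent (subst (+ n ℤ∣.∣_) (eq x) (ℤ∣.∣n⇒∣m*n 0ℤ ℤ∣.∣-refl))
    where
    eq : ∀ x → 0ℤ ≡ x ℤ.- x
    eq = solve-∀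

  mod-sym : ∀ {x y} → x ≈ y → y ≈ x
  mod-sym {x} {y} (congruent p) =
    congruent (subst (+ n ℤ∣.∣_) (eq x y) (ℤ∣.∣m⇒∣-m p))
    where
    eq : ∀ x y → ℤ.- (x ℤ.- y) ≡ y ℤ.- x
    eq = solve-∀

  mod-trans : ∀ {x y z} → x ≈ y → y ≈ z → x ≈ z
  mod-trans {x} {y} {z} (congruent p) (congruent q) =
    congruent (subst (+ n ℤ∣.∣_) (eq x y z) (ℤ∣.∣m∣n⇒∣m+n p q))
    where
    eq : ∀ x y z → (x ℤ.- y) ℤ.+ (y ℤ.- z) ≡ x ℤ.- z
    eq = solve-∀

  mod-+-cong : ∀ {x y u v} → x ≈ y → u ≈ v → x ℤ.+ u ≈ y ℤ.+ v
  mod-+-cong {x} {y} {u} {v} (congruent p) (congruent q) =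
    congruent (subst (+ n ℤ∣.∣_) (eq x y u v) (ℤ∣.∣m∣n⇒∣m+n p q))
    where
    eq : ∀ x y u v → (x ℤ.- y) ℤ.+ (u ℤ.- v) ≡ (x ℤ.+ u) ℤ.- (y ℤ.+ v)
    eq = solve-∀

  mod-*-cong : ∀ {x y u v} → x ≈ y → u ≈ v → x ℤ.* u ≈ y ℤ.* v
  mod-*-cong {x} {y} {u} {v} (congruent p) (congruent q) =
    congruent (subst (+ n ℤ∣.∣_) (eq x y u v)
      (ℤ∣.∣m∣n⇒∣m+n (ℤ∣.∣n⇒∣m*n u p) (ℤ∣.∣n⇒∣m*n y q)))
    where
    eq : ∀ x y u v →
         u ℤ.* (x ℤ.- y) ℤ.+ y ℤ.* (u ℤ.- v) ≡ x ℤ.* u ℤ.- y ℤ.* v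
    eq = solve-∀

  mod-neg-cong : ∀ {x y} → x ≈ y → ℤ.- x ≈ ℤ.- y
  mod-neg-cong {x} {y} (congruent p) =
    congruent (subst (+ n ℤ∣.∣_) (eq x y) (ℤ∣.∣m⇒∣-m p))
    where
    eq : ∀ x y → ℤ.- (x ℤ.- y) ≡ (ℤ.- x) ℤ.- (ℤ.- y)
    eq = solve-∀

-- The quotient is a setoid: its elements are integers, equal when congruent,
-- so that reducing an integer modulo n is the identity on carriers.
ℤ/_ : ℕ → CommutativeRing 0ℓ 0ℓ
ℤ/ n = record
  { Carrier = ℤ
  ; _≈_ = _≡_[mod n ]
  ; _+_ = ℤ._+_
  ; _*_ = ℤ._*_
  ; -_ = ℤ.-_
  ; 0# = 0ℤ
  ; 1# = 1ℤ
  ; isCommutativeRing = record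
    { isRing = record
      { +-isAbelianGroup = record
        { isGroup = record
          { isMonoid = record
            { isSemigroup = record
              { isMagma = record
                { isEquivalence = record
                  { refl = mod-reflexive refl
                  ; sym = mod-sym
                  ; trans = mod-trans
                  }
                ; ∙-cong = mod-+-cong
                }
              ; assoc = λ x y z → mod-reflexive (ℤ.+-assoc x y z)
              }
            ; identity = (λ x → mod-reflexive (ℤ.+-identityˡ x))
                       , (λ x → mod-reflexive (ℤ.+-identityʳ x))
            }
          ; inverse = (λ x → mod-reflexive (ℤ.+-inverseˡ x))
                    , (λ x → mod-reflexive (ℤ.+-inverseʳ x))
          ; ⁻¹-cong = mod-neg-cong
          }
        ; comm = λ x y → mod-reflexive (ℤ.+-comm x y)
        }
      ; *-cong = mod-*-cong
      ; *-assoc = λ x y z → mod-reflexive (ℤ.*-assoc x y z)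
      ; *-identity = (λ x → mod-reflexive (ℤ.*-identityˡ x))
                   , (λ x → mod-reflexive (ℤ.*-identityʳ x))
      ; distrib = (λ x y z → mod-reflexive (ℤ.*-distribˡ-+ x y z))
                , (λ x y z → mod-reflexive (ℤ.*-distribʳ-+ x y z))
      }
    ; *-comm = λ x y → mod-reflexive (ℤ.*-comm x y)
    }
  }

record Quaternion {ℓ} (A : Set ℓ) : Set ℓ where
  constructor quaternion
  field
    re im-i im-j im-k : A

open Quaternion public

module QuaternionAlgebra {c ℓ} (R : CommutativeRing c ℓ) where

  private module R = CommutativeRing R
  open R using (Carrier; _+_; _-_; 0#) renaming (_*_ to _·_)

  infix 4 _≈_
  infixl 7 _*_

  record _≈_ (q r : Quaternion Carrier) : Set ℓ where
    field
      re-≈ : re q R.≈ re r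
      i-≈  : im-i q R.≈ im-i r
      j-≈  : im-j q R.≈ im-j r
      k-≈  : im-k q R.≈ im-k r

  1# : Quaternion Carrier
  1# = quaternion R.1# 0# 0# 0#

  -- The bilinear extension of i² = j² = -1, ij = -ji = k; by associativity
  -- k² = -1, jk = -kj = i and ki = -ik = j.
  _*_ : Quaternion Carrier → Quaternion Carrier → Quaternion Carrier
  quaternion a b c d * quaternion a′ b′ c′ d′ = quaternion
    (a · a′ - b · b′ - c · c′ - d · d′)
    (a · b′ + b · a′ + c · d′ - d · c′)
    (a · c′ - b · d′ + c · a′ + d · b′)
    (a · d′ + b · c′ - c · b′ + d · a′)

  Invertible : Quaternion Carrier → Set _
  Invertible = AlgebraDefinitions.Invertible _≈_ 1# _*_

byParity : ∀ {ℓ} {A : Set ℓ} → A → A → Parity → A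
byParity even odd 0ℙ = even
byParity even odd 1ℙ = odd

R : ℤ → ℤ → ℕ → ℤ
R a b 0 = + 3
R a b 1 = + 0
R a b 2 = + 2
R a b n@(suc (suc (suc n-3))) =
  byParity a b (parity n) ℤ.* R a b (suc n-3) ℤ.+ R a b n-3

QR : ℤ → ℤ → ℕ → Quaternion ℤ
QR a b n = byParity (coeffs a b) (coeffs b a) (parity n)
  where
  coeffs : ℤ → ℤ → Quaternion ℤ
  coeffs a b =
    quaternion (R a b n) (R b a (1 ℕ.+ n)) (R a b (2 ℕ.+ n)) (R b a (3 ℕ.+ n))

{-# OPTIONS --safe #-}
-- The norm N(q) of a quaternion is the scalar q q̄, so q is invertible as soon
-- as N(q) is a unit.  Here z(13) = 7, so that m = 9 + 14 t.  Modulo 13 both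
-- Perrin sequences have period 56, which leaves the cases t = 0, 1, 2, 3;
-- there the norm of QR_m is ±2, i.e. N² = 4, whose inverse is 10.
module Submission where

open import Data.Nat using (ℕ; _∸_; _/_)
open import Data.Nat.Base using (parity)
open import Data.Integer using (+_; -_)
open import Data.Parity.Base using (1ℙ)
open import Relation.Binary.PropositionalEquality using (_≡_)
open import Defs

open import Data.Integer.Base as ℤ using (ℤ; 1ℤ)
open import Data.Integer.Divisibility.Signed as ℤ∣ using (∣⇒∣ᵤ)
open import Data.Integer.Properties using (*-assoc)
open import Data.Integer.Tactic.RingSolver using (solve-∀)
open import Data.Nat.Base as ℕ using (zero; suc; z≤n; s≤s)
open import Data.Nat.Divisibility using (_∣_; _∣?_; divides; ∣-refl)
open import Data.Nat.DivMod using (m*n/n≡m)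
open import Data.Nat.Properties using (+-comm; +-cancelʳ-≡)
open import Data.Parity.Base using (0ℙ)
open import Data.Product.Base using (∃-syntax; _×_; _,_; proj₁)
open import Relation.Binary.PropositionalEquality
  using (refl; sym; trans; cong; subst)
open import Relation.Nullary.Decidable using (Dec; map′; from-yes; from-no)
open import Relation.Nullary.Negation using (contradiction)

infix 4 _≡?_[mod_]

_≡?_[mod_] : ∀ x y n → Dec (x ≡ y [mod n ])
x ≡? y [mod n ] = map′ congruent _≡_[mod_].n∣x-y (+ n ℤ∣.∣? x ℤ.- y)

norm : Quaternion ℤ → ℤ
norm (quaternion a b c d) = a ℤ.* a ℤ.+ b ℤ.* b ℤ.+ c ℤ.* c ℤ.+ d ℤ.* d

module _ {n : ℕ} where
  open QuaternionAlgebra (ℤ/ n)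

  -- The inverse is `u` times the conjugate of `q`. In both products the imaginary parts cancel
  -- already over ℤ, so the hypothesis is used only for the real part.
  norm-unit⇒invertible : ∀ q u → norm q ℤ.* u ≡ 1ℤ [mod n ] → Invertible q
  norm-unit⇒invertible q@(quaternion a b c d) u Nu≡1 =
    quaternion (a ℤ.* u) (- (b ℤ.* u)) (- (c ℤ.* u)) (- (d ℤ.* u)) ,
    record
      { re-≈ = mod-trans (mod-reflexive (reˡ a b c d u)) Nu≡1
      ; i-≈  = mod-reflexive (iˡ a b c d u)
      ; j-≈  = mod-reflexive (jˡ a b c d u)
      ; k-≈  = mod-reflexive (kˡ a b c d u)
      } ,
    record
      { re-≈ = mod-trans (mod-reflexive (reʳ a b c d u)) Nu≡1
      ; i-≈  = mod-reflexive (iʳ a b c d u)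
      ; j-≈  = mod-reflexive (jʳ a b c d u)
      ; k-≈  = mod-reflexive (kʳ a b c d u)
      }
    where
    open import Data.Integer.Base using (_+_; _-_; 0ℤ) renaming (_*_ to _·_)

    reˡ : ∀ a b c d u →
      a · u · a - (- (b · u)) · b - (- (c · u)) · c - (- (d · u)) · d
      ≡ (a · a + b · b + c · c + d · d) · u
    reˡ = solve-∀

    iˡ : ∀ a b c d u →
      a · u · b + (- (b · u)) · a + (- (c · u)) · d - (- (d · u)) · c ≡ 0ℤ
    iˡ = solve-∀

    jˡ : ∀ a b c d u →
      a · u · c - (- (b · u)) · d + (- (c · u)) · a + (- (d · u)) · b ≡ 0ℤ
    jˡ = solve-∀

    kˡ : ∀ a b c d u →
      a · u · d + (- (b · u)) · c - (- (c · u)) · b + (- (d · u)) · a ≡ 0ℤ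
    kˡ = solve-∀

    reʳ : ∀ a b c d u →
      a · (a · u) - b · (- (b · u)) - c · (- (c · u)) - d · (- (d · u))
      ≡ (a · a + b · b + c · c + d · d) · u
    reʳ = solve-∀

    iʳ : ∀ a b c d u →
      a · (- (b · u)) + b · (a · u) + c · (- (d · u)) - d · (- (c · u)) ≡ 0ℤ
    iʳ = solve-∀

    jʳ : ∀ a b c d u →
      a · (- (c · u)) - b · (- (d · u)) + c · (a · u) + d · (- (b · u)) ≡ 0ℤ
    jʳ = solve-∀

    kʳ : ∀ a b c d u →
      a · (- (d · u)) + b · (- (c · u)) - c · (- (b · u)) + d · (a · u) ≡ 0ℤ
    kʳ = solve-∀

-- Evaluating R directly takes exponentially many steps; sliding a window of
-- three consecutive terms takes linearly many.
window : ℤ → ℤ → ℕ → ℤ × ℤ × ℤ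
window a b zero    = + 3 , + 0 , + 2
window a b (suc n) = slide (byParity a b (parity (suc n))) (window a b n)
  where
  slide : ℤ → ℤ × ℤ × ℤ → ℤ × ℤ × ℤ
  slide c (x , y , z) = y , z , c ℤ.* y ℤ.+ x

-- The term entering the window has index n + 3, whose parity reduces to that of n + 1, the one
-- tested by `window`.
window-correct : ∀ a b n →
  window a b n ≡ (R a b n , R a b (1 ℕ.+ n) , R a b (2 ℕ.+ n))
window-correct a b zero = refl
window-correct a b (suc n) rewrite window-correct a b n = refl

R-fast : ℤ → ℤ → ℕ → ℤ
R-fast a b n = proj₁ (window a b n)

R-fast≡R : ∀ a b n → R-fast a b n ≡ R a b n
R-fast≡R a b n = cong proj₁ (window-correct a b n)

parity-+ : ∀ c n → parity c ≡ 0ℙ → parity (n ℕ.+ c) ≡ parity n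
parity-+ c zero          even = even
parity-+ c 1             even = odd-suc c even
  where
  odd-suc : ∀ c → parity c ≡ 0ℙ → parity (suc c) ≡ 1ℙ
  odd-suc zero          _    = refl
  odd-suc (suc (suc c)) even = odd-suc c even
parity-+ c (suc (suc n)) even = parity-+ c n even

-- An even shift preserves which of `a`, `b` the recurrence uses, so agreement on three initial
-- terms propagates. These are stated with `R-fast` so that they can be decided by evaluation.
R-periodic : ∀ {p} a b c → parity c ≡ 0ℙ →
  R-fast a b c ≡ + 3 [mod p ] →
  R-fast a b (1 ℕ.+ c) ≡ + 0 [mod p ] →
  R-fast a b (2 ℕ.+ c) ≡ + 2 [mod p ] →
  ∀ n → R a b (n ℕ.+ c) ≡ R a b n [mod p ]
R-periodic {p} a b c even r₀ r₁ r₂ = go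
  where
  go : ∀ n → R a b (n ℕ.+ c) ≡ R a b n [mod p ]
  go 0 = mod-trans (mod-reflexive (sym (R-fast≡R a b c))) r₀
  go 1 = mod-trans (mod-reflexive (sym (R-fast≡R a b (1 ℕ.+ c)))) r₁
  go 2 = mod-trans (mod-reflexive (sym (R-fast≡R a b (2 ℕ.+ c)))) r₂
  go (suc (suc (suc n))) =
    mod-+-cong
      (mod-*-cong
        (mod-reflexive (cong (byParity a b) (parity-+ c (suc n) even)))
        (go (suc n)))
      (go n)

-- Abstracted over the sequence: `R` serves the theorem, `R-fast` the computations.
oddQuaternion : (ℤ → ℤ → ℕ → ℤ) → ℤ → ℤ → ℕ → Quaternion ℤ
oddQuaternion r a b n =
  quaternion (r b a n) (r a b (1 ℕ.+ n)) (r b a (2 ℕ.+ n)) (r a b (3 ℕ.+ n))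

QR-odd : ∀ a b n → parity n ≡ 1ℙ → QR a b n ≡ oddQuaternion R a b n
QR-odd a b n odd rewrite odd = refl

norm-cong : ∀ {n a a′ b b′ c c′ d d′} →
  a ≡ a′ [mod n ] → b ≡ b′ [mod n ] → c ≡ c′ [mod n ] → d ≡ d′ [mod n ] →
  norm (quaternion a b c d) ≡ norm (quaternion a′ b′ c′ d′) [mod n ]
norm-cong p q r s =
  mod-+-cong (mod-+-cong (mod-+-cong (mod-*-cong p p) (mod-*-cong q q))
    (mod-*-cong r r)) (mod-*-cong s s)

R-11-13-periodic : ∀ n → R (+ 11) (+ 13) (n ℕ.+ 56) ≡ R (+ 11) (+ 13) n [mod 13 ]
R-11-13-periodic = R-periodic (+ 11) (+ 13) 56 refl
  (from-yes (R-fast (+ 11) (+ 13) 56 ≡? + 3 [mod 13 ]))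
  (from-yes (R-fast (+ 11) (+ 13) 57 ≡? + 0 [mod 13 ]))
  (from-yes (R-fast (+ 11) (+ 13) 58 ≡? + 2 [mod 13 ]))

R-13-11-periodic : ∀ n → R (+ 13) (+ 11) (n ℕ.+ 56) ≡ R (+ 13) (+ 11) n [mod 13 ]
R-13-11-periodic = R-periodic (+ 13) (+ 11) 56 refl
  (from-yes (R-fast (+ 13) (+ 11) 56 ≡? + 3 [mod 13 ]))
  (from-yes (R-fast (+ 13) (+ 11) 57 ≡? + 0 [mod 13 ]))
  (from-yes (R-fast (+ 13) (+ 11) 58 ≡? + 2 [mod 13 ]))

N : ℕ → ℤ
N n = norm (oddQuaternion R (+ 11) (+ 13) n)

N-fast : ℕ → ℤ
N-fast n = norm (oddQuaternion R-fast (+ 11) (+ 13) n)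

N-fast≡N : ∀ n → N-fast n ≡ N n [mod 13 ]
N-fast≡N n = norm-cong
  (mod-reflexive (R-fast≡R (+ 13) (+ 11) n))
  (mod-reflexive (R-fast≡R (+ 11) (+ 13) (1 ℕ.+ n)))
  (mod-reflexive (R-fast≡R (+ 13) (+ 11) (2 ℕ.+ n)))
  (mod-reflexive (R-fast≡R (+ 11) (+ 13) (3 ℕ.+ n)))

N-periodic : ∀ n → N (n ℕ.+ 56) ≡ N n [mod 13 ]
N-periodic n = norm-cong
  (R-13-11-periodic n)
  (R-11-13-periodic (1 ℕ.+ n))
  (R-13-11-periodic (2 ℕ.+ n))
  (R-11-13-periodic (3 ℕ.+ n))

-- A record, so that comparing instances does not unfold R at a numeral.
record NormSquare4 (n : ℕ) : Set where
  constructor normSquare4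
  field
    N²≡4 : N n ℤ.* N n ≡ + 4 [mod 13 ]

open NormSquare4

N-fast²≡4 : ∀ n → N-fast n ℤ.* N-fast n ≡ + 4 [mod 13 ] → NormSquare4 n
N-fast²≡4 n eq =
  normSquare4 (mod-trans (mod-sym (mod-*-cong (N-fast≡N n) (N-fast≡N n))) eq)

N²≡4-periodic : ∀ n → NormSquare4 n → NormSquare4 (n ℕ.+ 56)
N²≡4-periodic n (normSquare4 eq) =
  normSquare4 (mod-trans (mod-*-cong (N-periodic n) (N-periodic n)) eq)

normSquare4-9+14t : ∀ t → NormSquare4 (1 ℕ.+ (4 ℕ.+ t ℕ.* 7) ℕ.* 2)
normSquare4-9+14t 0 =
  N-fast²≡4 9 (from-yes (N-fast 9 ℤ.* N-fast 9 ≡? + 4 [mod 13 ]))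
normSquare4-9+14t 1 =
  N-fast²≡4 23 (from-yes (N-fast 23 ℤ.* N-fast 23 ≡? + 4 [mod 13 ]))
normSquare4-9+14t 2 =
  N-fast²≡4 37 (from-yes (N-fast 37 ℤ.* N-fast 37 ≡? + 4 [mod 13 ]))
normSquare4-9+14t 3 =
  N-fast²≡4 51 (from-yes (N-fast 51 ℤ.* N-fast 51 ≡? + 4 [mod 13 ]))
normSquare4-9+14t (suc (suc (suc (suc t)))) =
  -- Four steps of 14 make one period: the index in the goal reduces to `56 + m`.
  subst NormSquare4 (+-comm m 56) (N²≡4-periodic m (normSquare4-9+14t t))
  where
  m : ℕ
  m = 1 ℕ.+ (4 ℕ.+ t ℕ.* 7) ℕ.* 2

-- Minimality applied to F 7 = 13 gives z ≤ 7, and 13 divides none of F 1, ..., F 6, which are 1, 1,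
-- 2, 3, 5, 8.
entryPoint-13 : ∀ z → IsEntryPoint 13 z → z ≡ 7
entryPoint-13 z e = bounded z positive divs (minimal (s≤s z≤n) ∣-refl)
  where
  open IsEntryPoint e renaming (divides to divs)

  bounded : ∀ z → 0 ℕ.< z → 13 ∣ F z → z ℕ.≤ 7 → z ≡ 7
  bounded 1 _ d _ = contradiction d (from-no (13 ∣? 1))
  bounded 2 _ d _ = contradiction d (from-no (13 ∣? 1))
  bounded 3 _ d _ = contradiction d (from-no (13 ∣? 2))
  bounded 4 _ d _ = contradiction d (from-no (13 ∣? 3))
  bounded 5 _ d _ = contradiction d (from-no (13 ∣? 5))
  bounded 6 _ d _ = contradiction d (from-no (13 ∣? 8))
  bounded 7 _ _ _ = refl
  bounded (suc (suc (suc (suc (suc (suc (suc (suc _)))))))) _ _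
    (s≤s (s≤s (s≤s (s≤s (s≤s (s≤s (s≤s ())))))))

-- In absolute values the congruence says that 7 divides k + 3. As k + 3 > 0, the quotient is some t
-- + 1, and 7(t + 1) - 3 = 4 + 7t.
k≡-3[mod7]⇒k≡4+t*7 : ∀ k → + k ≡ - (+ 3) [mod 7 ] → ∃[ t ] k ≡ 4 ℕ.+ t ℕ.* 7
k≡-3[mod7]⇒k≡4+t*7 k (congruent d) with ∣⇒∣ᵤ d
... | divides zero    eq = contradiction (trans (+-comm 3 k) eq) λ ()
... | divides (suc t) eq =
  t , +-cancelʳ-≡ 3 k _ (trans eq (+-comm 3 (4 ℕ.+ t ℕ.* 7)))

odd⇒≡1+2*half : ∀ m → parity m ≡ 1ℙ → m ≡ 1 ℕ.+ (m ∸ 1) / 2 ℕ.* 2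
odd⇒≡1+2*half m odd with half m odd
  where
  half : ∀ m → parity m ≡ 1ℙ → ∃[ k ] m ≡ 1 ℕ.+ k ℕ.* 2
  half 1             _   = 0 , refl
  half (suc (suc m)) odd with half m odd
  ... | k , refl = suc k , refl
-- With m = 1 + 2k substituted, the truncated subtraction reduces to `k * 2`, and the division by 2
-- is exact.
... | k , refl = cong (λ h → 1 ℕ.+ h ℕ.* 2) (sym (m*n/n≡m k 2))

corollary3 : ∀ (m z : ℕ) → IsEntryPoint 13 z → parity m ≡ 1ℙ →
    + ((m ∸ 1) / 2) ≡ - (+ 3) [mod z ] →
    QuaternionAlgebra.Invertible (ℤ/ 13) (QR (+ 11) (+ 13) m)
corollary3 m z e odd k≡-3
  -- This turns the modulus in the hypothesis on m into 7.
  with refl ← entryPoint-13 z e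
  with t , k≡4+t*7 ← k≡-3[mod7]⇒k≡4+t*7 ((m ∸ 1) / 2) k≡-3
  = subst (QuaternionAlgebra.Invertible (ℤ/ 13)) (sym (QR-odd _ _ m odd))
      -- From N² ≡ 4 and 4 · 10 = 40 ≡ 1 mod 13, the inverse of N is 10 N; squaring avoids tracking
      -- the sign of N ≡ ±2.
      (norm-unit⇒invertible (oddQuaternion R _ _ m) (N m ℤ.* + 10)
        (mod-trans (mod-reflexive (sym (*-assoc (N m) (N m) (+ 10))))
          (mod-trans (mod-*-cong N²≡4-m (mod-reflexive refl))
            (from-yes (+ 40 ≡? 1ℤ [mod 13 ])))))
  where
  m≡ : 1 ℕ.+ (4 ℕ.+ t ℕ.* 7) ℕ.* 2 ≡ m
  m≡ = sym (trans (odd⇒≡1+2*half m odd) (cong (λ h → 1 ℕ.+ h ℕ.* 2) k≡4+t*7))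

  N²≡4-m : N m ℤ.* N m ≡ + 4 [mod 13 ]
  N²≡4-m = N²≡4 (subst NormSquare4 m≡ (normSquare4-9+14t t))
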